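{- The class of $(K_4,2P_1+P_3)$-free graphs has bounded clique-width.
   Context: All graphs are finite, simple and undirected. A graph is $(H_1,H_2)$-free if it has no induced subgraph isomorphic to $H_1$ or to $H_2$. $K_4$ is the complete graph on 4 vertices, and $2P_1+P_3$ is the disjoint union of two isolated vertices and a path on 3 vertices. The clique-width of a graph $G$ is the minimum number $k$ of labels needed to construct $G$ using the operations: create a single vertex with label $i$; take the disjoint union of two labelled graphs; add all edges between vertices of label $i$ and vertices of label $j$ ($i\neq j$); rename label $i$ to $j$. A class of graphs has bounded clique-width if there is a constant $c$ such that every graph in the class has clique-width at most $c$. -}

module Defs where

open import Data.Nat using (ℕ; zero; suc; _+_)
open import Data.Fin using (Fin; zero; suc; splitAt; _≟_)
open import Data.Bool using (Bool; true; false; _∧_; _∨_; not; if_then_else_)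
open import Data.Sum using (_⊎_; inj₁; inj₂)
open import Data.Product using (Σ; ∃; _×_; _,_)
open import Data.Empty using (⊥)
open import Relation.Nullary using (¬_)
open import Relation.Nullary.Decidable using (⌊_⌋)
open import Relation.Binary.PropositionalEquality using (_≡_; refl; _≢_)
open import Function.Bundles using (_↔_; Inverse)
open import Function.Definitions using (Injective)

_==_ : ∀ {n} → Fin n → Fin n → Bool
x == y = ⌊ x ≟ y ⌋

record Graph (n : ℕ) : Set where
  field
    adj    : Fin n → Fin n → Bool
    sym    : ∀ x y → adj x y ≡ adj y x
    irrefl : ∀ x → adj x x ≡ false
open Graph public

InducedSub : ∀ {k n} → Graph k → Graph n → Set
InducedSub {k} {n} H G =
  Σ (Fin k → Fin n) λ f →
    Injective _≡_ _≡_ f × (∀ x y → adj H x y ≡ adj G (f x) (f y))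

K4 : Graph 4
K4 = record
  { adj = λ x y → not (x == y)
  ; sym = symK
  ; irrefl = irrK }
  where
  symK : ∀ (x y : Fin 4) → not (x == y) ≡ not (y == x)
  symK zero zero = refl
  symK zero (suc zero) = refl
  symK zero (suc (suc zero)) = refl
  symK zero (suc (suc (suc zero))) = refl
  symK (suc zero) zero = refl
  symK (suc zero) (suc zero) = refl
  symK (suc zero) (suc (suc zero)) = refl
  symK (suc zero) (suc (suc (suc zero))) = refl
  symK (suc (suc zero)) zero = refl
  symK (suc (suc zero)) (suc zero) = refl
  symK (suc (suc zero)) (suc (suc zero)) = refl
  symK (suc (suc zero)) (suc (suc (suc zero))) = refl
  symK (suc (suc (suc zero))) zero = refl
  symK (suc (suc (suc zero))) (suc zero) = refl
  symK (suc (suc (suc zero))) (suc (suc zero)) = refl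
  symK (suc (suc (suc zero))) (suc (suc (suc zero))) = refl
  irrK : ∀ (x : Fin 4) → not (x == x) ≡ false
  irrK zero = refl
  irrK (suc zero) = refl
  irrK (suc (suc zero)) = refl
  irrK (suc (suc (suc zero))) = refl

-- 2P1 + P3: vertices 0,1 isolated; path 2 - 3 - 4
private
  p3edge : Fin 5 → Fin 5 → Bool
  p3edge (suc (suc zero)) (suc (suc (suc zero))) = true
  p3edge (suc (suc (suc zero))) (suc (suc (suc (suc zero)))) = true
  p3edge _ _ = false

  ∨-comm : ∀ a b → (a ∨ b) ≡ (b ∨ a)
  ∨-comm false false = refl
  ∨-comm false true = refl
  ∨-comm true false = refl
  ∨-comm true true = refl

2P1+P3 : Graph 5
2P1+P3 = record
  { adj = λ x y → p3edge x y ∨ p3edge y x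
  ; sym = λ x y → ∨-comm (p3edge x y) (p3edge y x)
  ; irrefl = irr }
  where
  irr : ∀ (x : Fin 5) → (p3edge x x ∨ p3edge x x) ≡ false
  irr zero = refl
  irr (suc zero) = refl
  irr (suc (suc zero)) = refl
  irr (suc (suc (suc zero))) = refl
  irr (suc (suc (suc (suc zero)))) = refl

Free : ∀ {a b n} → Graph a → Graph b → Graph n → Set
Free H1 H2 G = ¬ InducedSub H1 G × ¬ InducedSub H2 G

data CWExpr (k : ℕ) : ℕ → Set where
  vertex  : Fin k → CWExpr k 1
  union   : ∀ {m n} → CWExpr k m → CWExpr k n → CWExpr k (m + n)
  join    : ∀ {n} (i j : Fin k) → i ≢ j → CWExpr k n → CWExpr k n
  relabel : ∀ {n} (i j : Fin k) → CWExpr k n → CWExpr k n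

label : ∀ {k n} → CWExpr k n → Fin n → Fin k
label (vertex i) _ = i
label (union {m} e₁ e₂) x with splitAt m x
... | inj₁ a = label e₁ a
... | inj₂ b = label e₂ b
label (join i j _ e) x = label e x
label (relabel i j e) x = if label e x == i then j else label e x

edge : ∀ {k n} → CWExpr k n → Fin n → Fin n → Bool
edge (vertex i) _ _ = false
edge (union {m} e₁ e₂) x y with splitAt m x | splitAt m y
... | inj₁ a | inj₁ b = edge e₁ a b
... | inj₂ a | inj₂ b = edge e₂ a b
... | _      | _      = false
edge (join i j _ e) x y =
  edge e x y ∨ ((label e x == i ∧ label e y == j) ∨ (label e x == j ∧ label e y == i))
edge (relabel i j e) x y = edge e x y

CliqueWidth≤ : ∀ {n} → Graph n → ℕ → Set
CliqueWidth≤ {n} G k =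
  Σ (CWExpr k n) λ e →
    Σ (Fin n ↔ Fin n) λ σ →
      ∀ x y → adj G x y ≡ edge e (Inverse.to σ x) (Inverse.to σ y)

{-# OPTIONS --safe #-}

-- After deleting boundedly many vertices, the graph becomes complete multipartite with at most
-- three parts up to complementing a set of pairs of maximum degree 2.  For an independent set I
-- of size 5, 2P₁+P₃-freeness makes every vertex either low (at most one neighbour in I) or high
-- (at most one non-neighbour in I); low vertices induce a disjoint union of cliques, high
-- vertices induce a triangle-free graph, and the low non-neighbours of a high vertex form a
-- clique.  Ramsey's theorem supplies such a set I in the graph, then J among the vertices high
-- for I, then K among the vertices high for both, unless the set in question has bounded size.
-- Up to bounded sets, the parts are the vertices low for exactly one of I, J, K.
--
-- Deleted vertices are put back by refining the vertex types by adjacency to them.  A graph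
-- of maximum degree 2 has an ordering in which at most two edges leave each initial segment,
-- so two extra labels for the ends of these edges suffice to build the graph vertex by vertex.

module Submission where

open import Defs renaming (sym to adj-sym; irrefl to adj-irrefl)
open import Data.Bool using (Bool; true; false; not; if_then_else_)
import Data.Bool.Properties as Bool
open import Data.Empty using (⊥; ⊥-elim)
open import Data.Fin using (Fin; zero; suc; splitAt; _≟_; _↑ˡ_; _↑ʳ_; combine; remQuot)
open import Data.Fin.Patterns using (0F; 1F; 2F; 3F; 4F)
open import Data.Fin.Properties
  using (any?; all?; injective⇒≤; ↑ˡ-injective; ↑ʳ-injective; splitAt-↑ˡ; splitAt-↑ʳ;
         remQuot-combine)
open import Data.List using (List; []; _∷_; _++_; length; lookup; allFin)
import Data.List.Membership.DecPropositional as DecPropositional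
open import Data.List.Membership.Propositional using (_∈_; _∉_)
open import Data.List.Membership.Propositional.Properties using (∈-allFin; ∈-lookup; ∈-++⁺ˡ; ∈-++⁺ʳ)
open import Data.List.Properties using (length-++)
import Data.List.Relation.Unary.All as All
import Data.List.Relation.Unary.All.Properties as All
open import Data.List.Relation.Unary.AllPairs using ([]; _∷_)
open import Data.List.Relation.Unary.Any using (here; there; index)
open import Data.List.Relation.Unary.Any.Properties using (lookup-index)
open import Data.List.Relation.Unary.Unique.Propositional using (Unique)
open import Data.Nat using (ℕ; zero; suc; _+_; _*_; _≤_; z≤n; s≤s)
import Data.Nat.Properties as ℕ
open import Data.Product using (Σ; ∃; ∃₂; _×_; _,_; proj₁; proj₂)
open import Data.Sum as Sum using (_⊎_; inj₁; inj₂)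
open import Data.Unit using (⊤; tt)
open import Data.Vec.Functional using () renaming (_∷_ to _◂_)
open import Function using (_∘_; case_of_)
open import Function.Bundles using (_↔_; mk↔ₛ′; Inverse)
open import Relation.Binary.PropositionalEquality
  using (_≡_; _≢_; refl; sym; trans; cong; cong₂; subst)
open import Relation.Nullary using (Dec; yes; no; ¬_; ¬?)
open import Relation.Nullary.Decidable using (_×-dec_; _⊎-dec_; _→-dec_; decidable-stable; from-yes)

-- Building clique-width expressions vertex by vertex

==-true : ∀ {n} {x y : Fin n} → x ≡ y → (x == y) ≡ true
==-true {x = x} {y} x≡y with x ≟ y
... | yes _ = refl
... | no x≢y = ⊥-elim (x≢y x≡y)

==-false : ∀ {n} {x y : Fin n} → x ≢ y → (x == y) ≡ false
==-false {x = x} {y} x≢y with x ≟ y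
... | yes x≡y = ⊥-elim (x≢y x≡y)
... | no _ = refl

edge-sym : ∀ {k n} (e : CWExpr k n) x y → edge e x y ≡ edge e y x
edge-sym (vertex i) x y = refl
edge-sym (union {m} e₁ e₂) x y with splitAt m x | splitAt m y
... | inj₁ a | inj₁ b = edge-sym e₁ a b
... | inj₁ _ | inj₂ _ = refl
... | inj₂ _ | inj₁ _ = refl
... | inj₂ a | inj₂ b = edge-sym e₂ a b
edge-sym (join i j _ e) x y
  rewrite edge-sym e x y
  with label e x == i | label e x == j | label e y == i | label e y == j
... | false | false | false | false = refl
... | false | false | false | true = refl
... | false | false | true | false = refl
... | false | false | true | true = refl
... | false | true | false | false = refl
... | false | true | false | true = refl
... | false | true | true | false = refl
... | false | true | true | true = refl
... | true | false | false | false = refl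
... | true | false | false | true = refl
... | true | false | true | false = refl
... | true | false | true | true = refl
... | true | true | false | false = refl
... | true | true | false | true = refl
... | true | true | true | false = refl
... | true | true | true | true = refl
edge-sym (relabel i j e) x y = edge-sym e x y

module _ {k K : ℕ} (a b : Fin k → Fin K)
  (a-injective : ∀ {i j} → a i ≡ a j → i ≡ j) (a≢b : ∀ i j → a i ≢ b j) where

  -- Since no `b j` is an `a i`, a vertex that has been moved is never moved again; the successive
  -- renamings therefore act like a simultaneous one.
  relabels : ∀ {m} → List (Fin k) → CWExpr K m → CWExpr K m
  relabels []      e = e
  relabels (i ∷ l) e = relabel (a i) (b i) (relabels l e)

  edge-relabels : ∀ {m} l (e : CWExpr K m) x y → edge (relabels l e) x y ≡ edge e x y
  edge-relabels []      e x y = refl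
  edge-relabels (i ∷ l) e x y = edge-relabels l e x y

  label-relabels-fixed : ∀ {m} l (e : CWExpr K m) {x} → (∀ i → label e x ≢ a i) →
    label (relabels l e) x ≡ label e x
  label-relabels-fixed []      e fixed = refl
  label-relabels-fixed (i ∷ l) e fixed
    rewrite label-relabels-fixed l e fixed | ==-false (fixed i) = refl

  label-relabels-cases : ∀ {m} l (e : CWExpr K m) {x i} → label e x ≡ a i →
    label (relabels l e) x ≡ b i ⊎ (i ∉ l × label (relabels l e) x ≡ a i)
  label-relabels-cases []      e eq = inj₂ ((λ ()) , eq)
  label-relabels-cases (j ∷ l) e {i = i} eq with label-relabels-cases l e eq
  ... | inj₁ p rewrite p | ==-false (a≢b j i ∘ sym) = inj₁ refl
  ... | inj₂ (i∉l , p) rewrite p with i ≟ j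
  ...   | yes refl rewrite ==-true {x = a i} refl = inj₁ refl
  ...   | no i≢j rewrite ==-false (i≢j ∘ a-injective) =
          inj₂ ((λ { (here i≡j) → i≢j i≡j ; (there i∈l) → i∉l i∈l }) , refl)

  label-relabels : ∀ {m} (e : CWExpr K m) {x i} → label e x ≡ a i →
    label (relabels (allFin k) e) x ≡ b i
  label-relabels e {i = i} eq with label-relabels-cases (allFin k) e eq
  ... | inj₁ p = p
  ... | inj₂ (i∉ , _) = ⊥-elim (i∉ (∈-allFin i))

module _ {k K : ℕ} (a : Fin k → Fin K) (a-injective : ∀ {i j} → a i ≡ a j → i ≡ j)
  (β : Fin k → Bool) (c : Fin K) (a≢c : ∀ i → a i ≢ c) where

  joins : ∀ {m} → List (Fin k) → CWExpr K m → CWExpr K m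
  joins []      e = e
  joins (i ∷ l) e = if β i then join (a i) c (a≢c i) (joins l e) else joins l e

  label-joins : ∀ {m} l (e : CWExpr K m) x → label (joins l e) x ≡ label e x
  label-joins []      e x = refl
  label-joins (i ∷ l) e x with β i
  ... | true  = label-joins l e x
  ... | false = label-joins l e x

  edge-joins-≢ : ∀ {m} l (e : CWExpr K m) {x y} → label e x ≢ c → label e y ≢ c →
    edge (joins l e) x y ≡ edge e x y
  edge-joins-≢ []      e x≢c y≢c = refl
  edge-joins-≢ (i ∷ l) e {x} {y} x≢c y≢c with β i
  ... | false = edge-joins-≢ l e x≢c y≢c
  ... | true rewrite edge-joins-≢ l e x≢c y≢c | label-joins l e x | label-joins l e y
                   | ==-false x≢c | ==-false y≢c
       with edge e x y | label e x == a i
  ...   | false | false = refl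
  ...   | false | true = refl
  ...   | true | _ = refl

  edge-joins-≡ : ∀ {m} l (e : CWExpr K m) {x y} → label e x ≡ c → label e y ≡ c →
    edge (joins l e) x y ≡ edge e x y
  edge-joins-≡ []      e x≡c y≡c = refl
  edge-joins-≡ (i ∷ l) e {x} {y} x≡c y≡c with β i
  ... | false = edge-joins-≡ l e x≡c y≡c
  ... | true rewrite edge-joins-≡ l e x≡c y≡c | label-joins l e x | label-joins l e y
                   | x≡c | y≡c | ==-false (a≢c i ∘ sym)
       with edge e x y | c == c
  ...   | false | false = refl
  ...   | false | true = refl
  ...   | true | _ = refl

  -- The second alternative is an induction invariant: only the join for `i` itself can affect this
  -- pair, because `a` is injective and avoids `c`. Over `allFin k` that alternative cannot occur.
  edge-joins-cases : ∀ {m} l (e : CWExpr K m) {x y i} →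
    label e x ≡ c → label e y ≡ a i → edge e x y ≡ false →
    edge (joins l e) x y ≡ β i ⊎ (i ∉ l × edge (joins l e) x y ≡ false)
  edge-joins-cases []      e lx ly exy = inj₂ ((λ ()) , exy)
  edge-joins-cases (j ∷ l) e {x} {y} {i} lx ly exy with i ≟ j
  edge-joins-cases (j ∷ l) e {x} {y} {i} lx ly exy | yes refl
    with β i | edge-joins-cases l e lx ly exy
  ... | false | inj₁ p = inj₁ p
  ... | false | inj₂ (_ , p) = inj₁ p
  ... | true | inj₁ p rewrite p = inj₁ refl
  ... | true | inj₂ (_ , p)
      rewrite p | label-joins l e x | label-joins l e y | lx | ly
            | ==-false (a≢c i ∘ sym) | ==-true {x = c} refl | ==-true {x = a i} refl = inj₁ refl
  edge-joins-cases (j ∷ l) e {x} {y} {i} lx ly exy | no i≢j =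
    Sum.map (trans unchanged)
      (λ (i∉l , p) → (λ { (here i≡j) → i≢j i≡j ; (there i∈l) → i∉l i∈l }) , trans unchanged p)
      (edge-joins-cases l e lx ly exy)
    where
    unchanged : edge (joins (j ∷ l) e) x y ≡ edge (joins l e) x y
    unchanged with β j
    ... | false = refl
    ... | true rewrite label-joins l e x | label-joins l e y | lx | ly
                     | ==-false (a≢c j ∘ sym) | ==-false (i≢j ∘ a-injective)
                     | ==-true {x = c} refl = Bool.∨-comm _ false

  edge-joins : ∀ {m} (e : CWExpr K m) {x y i} →
    label e x ≡ c → label e y ≡ a i → edge e x y ≡ false →
    edge (joins (allFin k) e) x y ≡ β i
  edge-joins e {i = i} lx ly exy with edge-joins-cases (allFin k) e lx ly exy
  ... | inj₁ p = p
  ... | inj₂ (i∉ , _) = ⊥-elim (i∉ (∈-allFin i))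

↑ˡ≢↑ʳ : ∀ {k} (i j : Fin k) → i ↑ˡ k ≢ k ↑ʳ j
↑ˡ≢↑ʳ {k} i j eq
  with () ← trans (sym (splitAt-↑ˡ k i k)) (trans (cong (splitAt k) eq) (splitAt-↑ʳ k k j))

module _ {n : ℕ} (G : Graph n) {k : ℕ} where

  -- The labels k ↑ʳ j are working space: they are unused between steps.
  Prefix : List (Fin n) → (Fin n → Fin k) → Set
  Prefix S ℓ = Σ (CWExpr (k + k) (length S)) λ e →
    (∀ i → label e i ≡ ℓ (lookup S i) ↑ˡ k) ×
    (∀ i j → edge e i j ≡ adj G (lookup S i) (lookup S j))

  -- The vertex `w` enters with a label from the right half, so joining left labels to it creates
  -- only edges at `w`. The old labels then move by `g` into the right half, which keeps sources and
  -- targets disjoint, and a second pass brings everything back to the left.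
  Prefix-∷ : ∀ {w S ℓ ℓ′} (β : Fin k → Bool) (g : Fin k → Fin k) →
    (∀ {x} → x ∈ S → adj G w x ≡ β (ℓ x)) →
    (∀ {x} → x ∈ S → ℓ′ x ≡ g (ℓ x)) →
    Prefix S ℓ → Prefix (w ∷ S) ℓ′
  Prefix-∷ {w} {S} {ℓ} {ℓ′} β g adj-β ℓ′-g (e , e-label , e-edge) =
    e₄ , label₄ , edge₄
    where
    left right : Fin k → Fin (k + k)
    left  i = i ↑ˡ k
    right i = k ↑ʳ i
    left-injective : ∀ {i j} → left i ≡ left j → i ≡ j
    left-injective {i} {j} = ↑ˡ-injective k i j
    right-injective : ∀ {i j} → right i ≡ right j → i ≡ j
    right-injective {i} {j} = ↑ʳ-injective k i j
    left≢right : ∀ i j → left i ≢ right j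
    left≢right = ↑ˡ≢↑ʳ
    right≢left : ∀ i j → right i ≢ left j
    right≢left i j = left≢right j i ∘ sym
    c : Fin (k + k)
    c = right (ℓ′ w)
    a≢c : ∀ i → left i ≢ c
    a≢c i = left≢right i (ℓ′ w)
    e₁ e₂ e₃ e₄ : CWExpr (k + k) (suc (length S))
    e₁ = union (vertex c) e
    e₂ = joins left left-injective β c a≢c (allFin k) e₁
    e₃ = relabels left (right ∘ g) left-injective (λ i j → left≢right i (g j)) (allFin k) e₂
    e₄ = relabels right left right-injective right≢left (allFin k) e₃
    label₂ : ∀ x → label e₂ x ≡ label e₁ x
    label₂ = label-joins left left-injective β c a≢c (allFin k) e₁
    label₄ : ∀ i → label e₄ i ≡ left (ℓ′ (lookup (w ∷ S) i))
    label₄ zero = label-relabels right left right-injective right≢left e₃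
      (trans (label-relabels-fixed left (right ∘ g) left-injective (λ i j → left≢right i (g j))
               (allFin k) e₂ (λ i eq → right≢left (ℓ′ w) i (trans (sym (label₂ zero)) eq)))
             (label₂ zero))
    label₄ (suc i) = trans
      (label-relabels right left right-injective right≢left e₃
        (label-relabels left (right ∘ g) left-injective (λ i j → left≢right i (g j)) e₂
          (trans (label₂ (suc i)) (e-label i))))
      (cong left (sym (ℓ′-g (∈-lookup i))))
    edge₂ : ∀ i j → edge e₂ i j ≡ adj G (lookup (w ∷ S) i) (lookup (w ∷ S) j)
    edge₂ zero zero = trans
      (edge-joins-≡ left left-injective β c a≢c (allFin k) e₁ {zero} {zero} refl refl)
      (sym (adj-irrefl G w))
    edge₂ zero (suc j) = trans
      (edge-joins left left-injective β c a≢c e₁ {zero} {suc j} refl (e-label j) refl)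
      (sym (adj-β (∈-lookup j)))
    edge₂ (suc i) zero = trans (edge-sym e₂ (suc i) zero) (trans (edge₂ zero (suc i))
      (adj-sym G w (lookup S i)))
    edge₂ (suc i) (suc j) = trans
      (edge-joins-≢ left left-injective β c a≢c (allFin k) e₁ {suc i} {suc j}
        (λ eq → a≢c _ (trans (sym (e-label i)) eq))
        (λ eq → a≢c _ (trans (sym (e-label j)) eq)))
      (e-edge i j)
    edge₄ : ∀ i j → edge e₄ i j ≡ adj G (lookup (w ∷ S) i) (lookup (w ∷ S) j)
    edge₄ i j = trans
      (edge-relabels right left right-injective right≢left (allFin k) e₃ i j)
      (trans (edge-relabels left (right ∘ g) left-injective (λ i j → left≢right i (g j)) (allFin k) e₂ i j)
        (edge₂ i j))

-- Graphs of degree at most two relative to a typing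

_∈?_ : ∀ {n} (x : Fin n) (S : List (Fin n)) → Dec (x ∈ S)
_∈?_ = DecPropositional._∈?_ _≟_

lookup-injective : ∀ {A : Set} {S : List A} → Unique S → ∀ {i j} → lookup S i ≡ lookup S j → i ≡ j
lookup-injective (_ ∷ _) {zero} {zero} eq = refl
lookup-injective (x∉S ∷ _) {zero} {suc j} eq = ⊥-elim (All.lookup x∉S (∈-lookup j) eq)
lookup-injective (x∉S ∷ _) {suc i} {zero} eq = ⊥-elim (All.lookup x∉S (∈-lookup i) (sym eq))
lookup-injective (_ ∷ u) {suc i} {suc j} eq = cong suc (lookup-injective u eq)

∉-∷ : ∀ {n} {x y : Fin n} {S} → x ≢ y → x ∉ S → x ∉ y ∷ S
∉-∷ x≢y x∉S (here x≡y) = x≢y x≡y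
∉-∷ x≢y x∉S (there x∈S) = x∉S x∈S

-- Outside X, the graph is obtained from the blow-up of M by complementing a set of pairs in
-- which every vertex lies at most twice.
record Typing {n} (G : Graph n) (t : ℕ) (X : List (Fin n)) : Set where
  field
    type    : Fin n → Fin t
    M       : Fin t → Fin t → Bool
    M-sym   : ∀ c d → M c d ≡ M d c
    flipped : ∀ w → w ∉ X → Σ (Fin n) λ d₁ → Σ (Fin n) λ d₂ →
      ∀ z → z ∉ X → z ≢ w → adj G w z ≢ M (type w) (type z) → z ≡ d₁ ⊎ z ≡ d₂

-- Orderings in which at most two flipped pairs leave each initial segment

module _ {n t} (G : Graph (suc n)) (T : Typing G t []) where
  open Typing T

  private
    V : Set
    V = Fin (suc n)
    k : ℕ
    k = suc (suc t)

  Flip : V → V → Set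
  Flip x z = z ≢ x × adj G x z ≢ M (type x) (type z)

  Flip-sym : ∀ {x z} → Flip x z → Flip z x
  Flip-sym {x} {z} (z≢x , ne) =
    z≢x ∘ sym , λ eq → ne (trans (adj-sym G x z) (trans eq (M-sym _ _)))

  Flip? : ∀ x z → Dec (Flip x z)
  Flip? x z = ¬? (z ≟ x) ×-dec ¬? (adj G x z Bool.≟ M (type x) (type z))

  Cut : List V → V × V → Set
  Cut S (x , z) = x ∈ S × z ∉ S × Flip x z

  CutWithin : List V → V × V → V × V → Set
  CutWithin S e₁ e₂ = ∀ e → Cut S e → e ≡ e₁ ⊎ e ≡ e₂

  Active : List V → V → Set
  Active S x = ∃ λ z → z ∉ S × Flip x z

  active? : ∀ S x → Dec (Active S x)
  active? S x = any? λ z → ¬? (z ∈? S) ×-dec Flip? x z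

  slot : ∀ {A B : Set} → Dec A → Dec B → Fin t → Fin k
  slot (no _)  _       c = suc (suc c)
  slot (yes _) (yes _) c = zero
  slot (yes _) (no _)  c = suc zero

  -- Vertices of S with equal labels have the same neighbours outside S: at most two vertices
  -- are active, and those get private labels.
  labelling : List V → V → V → Fin k
  labelling S p x = slot (active? S x) (x ≟ p) (type x)

  -- Each of the two private labels belongs to at most one vertex, `p` or `q`, so `β` and `g` can be
  -- read off there. An inactive vertex forms no flipped pair with `w`, so its type decides the
  -- adjacency, and it stays inactive as the segment grows.
  extend : ∀ {S w p q} p′ → w ∉ S →
    (∀ {x} → x ∈ S → Active S x → x ≡ p ⊎ x ≡ q) →
    Prefix G S (labelling S p) → Prefix G (w ∷ S) (labelling (w ∷ S) p′)
  extend {S} {w} {p} {q} p′ w∉S active = Prefix-∷ G {ℓ = labelling S p} β g adj-β label-g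
    where
    β : Fin k → Bool
    β zero = adj G w p
    β (suc zero) = adj G w q
    β (suc (suc c)) = M (type w) c
    g : Fin k → Fin k
    g zero = labelling (w ∷ S) p′ p
    g (suc zero) = labelling (w ∷ S) p′ q
    g (suc (suc c)) = suc (suc c)
    adj-β : ∀ {x} → x ∈ S → adj G w x ≡ β (labelling S p x)
    adj-β {x} x∈S with active? S x | x ≟ p
    ... | yes a | yes refl = refl
    ... | yes a | no x≢p with active x∈S a
    ...   | inj₁ x≡p = ⊥-elim (x≢p x≡p)
    ...   | inj₂ refl = refl
    adj-β {x} x∈S | no ¬a | _ = decidable-stable (_ Bool.≟ _) λ ne →
      ¬a (w , w∉S , Flip-sym ((λ { refl → w∉S x∈S }) , ne))
    label-g : ∀ {x} → x ∈ S → labelling (w ∷ S) p′ x ≡ g (labelling S p x)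
    label-g {x} x∈S with active? S x | x ≟ p
    ... | yes a | yes refl = refl
    ... | yes a | no x≢p with active x∈S a
    ...   | inj₁ x≡p = ⊥-elim (x≢p x≡p)
    ...   | inj₂ refl = refl
    label-g {x} x∈S | no ¬a | _ with active? (w ∷ S) x
    ... | no _ = refl
    ... | yes (z , z∉ , f) = ⊥-elim (¬a (z , z∉ ∘ there , f))

  record Layout (S : List V) : Set where
    field
      unique : Unique S
      e₁ e₂  : V × V
      within : CutWithin S e₁ e₂
      prefix : Prefix G S (labelling S (proj₁ e₁))

  Layout-∷ : ∀ {S w} e₁′ e₂′ → w ∉ S → CutWithin (w ∷ S) e₁′ e₂′ → Layout S → Layout (w ∷ S)
  Layout-∷ e₁′ e₂′ w∉S within′ L = record
    { unique = All.¬Any⇒All¬ _ w∉S ∷ unique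
    ; e₁ = e₁′ ; e₂ = e₂′ ; within = within′
    ; prefix = extend (proj₁ e₁′) w∉S
        -- An active vertex is the inner end of a cut pair, hence of `e₁` or `e₂`.
        (λ x∈S (z , z∉S , f) → Sum.map (cong proj₁) (cong proj₁) (within (_ , z) (x∈S , z∉S , f)))
        prefix
    }
    where open Layout L

  -- Adding the outer end w of a cut pair e₁ trades e₁ for at most one new cut pair.
  follow : ∀ {S x w e₁ e₂} → CutWithin S e₁ e₂ → Cut S (x , w) → (x , w) ≡ e₁ →
    ∃ λ e₁′ → CutWithin (w ∷ S) e₁′ e₂
  follow {S} {x} {w} {e₂ = e₂} within (x∈S , w∉S , f) refl with flipped w (λ ())
  ... | d₁ , d₂ , bound = helper (bound x (λ ()) (proj₁ (Flip-sym f)) (proj₂ (Flip-sym f)))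
    where
    old : ∀ {y z} → y ∈ S → z ∉ w ∷ S → Flip y z → (y , z) ≡ e₂
    old y∈S z∉ f′ with within _ (y∈S , z∉ ∘ there , f′)
    ... | inj₁ refl = ⊥-elim (z∉ (here refl))
    ... | inj₂ eq = eq
    -- One of the two possible flip partners of `w` is `x`, which already lies in `S`; only the
    -- other can lie outside.
    helper : x ≡ d₁ ⊎ x ≡ d₂ → ∃ λ e₁′ → CutWithin (w ∷ S) e₁′ e₂
    helper (inj₁ refl) = (w , d₂) , λ where
      (y , z) (there y∈S , z∉ , f′) → inj₂ (old y∈S z∉ f′)
      (y , z) (here refl , z∉ , f′) → case (bound z (λ ()) (proj₁ f′) (proj₂ f′)) of λ where
        (inj₁ refl) → ⊥-elim (z∉ (there x∈S))
        (inj₂ refl) → inj₁ refl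
    helper (inj₂ refl) = (w , d₁) , λ where
      (y , z) (there y∈S , z∉ , f′) → inj₂ (old y∈S z∉ f′)
      (y , z) (here refl , z∉ , f′) → case (bound z (λ ()) (proj₁ f′) (proj₂ f′)) of λ where
        (inj₂ refl) → ⊥-elim (z∉ (there x∈S))
        (inj₁ refl) → inj₁ refl

  -- As nothing leaves `S`, every new cut pair starts at `w`, which has at most two flip partners.
  fresh : ∀ {S} w → (∀ e → ¬ Cut S e) → Σ (V × V) λ e₁ → Σ (V × V) λ e₂ → CutWithin (w ∷ S) e₁ e₂
  fresh w uncut with flipped w (λ ())
  ... | d₁ , d₂ , bound = (w , d₁) , (w , d₂) , λ where
    (y , z) (there y∈S , z∉ , f) → ⊥-elim (uncut _ (y∈S , z∉ ∘ there , f))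
    (y , z) (here refl , z∉ , f) →
      Sum.map (cong (w ,_)) (cong (w ,_)) (bound z (λ ()) (proj₁ f) (proj₂ f))

  -- The given `z` is taken only when no pair is cut. Otherwise the outer end of a cut pair has to
  -- come next, since an arbitrary vertex could bring two further cut pairs.
  grow : ∀ {S z} → z ∉ S → Layout S → ∃ λ w → w ∉ S × Layout (w ∷ S)
  grow {S} {z} z∉S L
    with any? (λ x → any? (λ w → (x ∈? S) ×-dec (¬? (w ∈? S) ×-dec Flip? x w)))
  ... | no uncut with fresh {S} z (λ (x , w) c → uncut (x , w , c))
  ...   | e₁′ , e₂′ , within′ = z , z∉S , Layout-∷ e₁′ e₂′ z∉S within′ L
  grow {S} {z} z∉S L | yes (x , w , cut@(_ , w∉S , _)) with Layout.within L (x , w) cut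
  ... | inj₁ eq with follow (Layout.within L) cut eq
  ...   | e′ , within′ = w , w∉S , Layout-∷ e′ _ w∉S within′ L
  grow {S} {z} z∉S L | yes (x , w , cut@(_ , w∉S , _)) | inj₂ eq
    with follow (λ e c → Sum.swap (Layout.within L e c)) cut eq
  ... | e′ , within′ = w , w∉S , Layout-∷ e′ _ w∉S within′ L

  -- The base has one vertex because no expression denotes the empty graph.
  initial : Layout (zero ∷ [])
  initial with fresh {[]} zero (λ _ ())
  ... | e₁ , e₂ , within = record
    { unique = All.[] ∷ []
    ; e₁ = e₁ ; e₂ = e₂ ; within = within
    ; prefix = vertex (labelling _ (proj₁ e₁) zero ↑ˡ k)
             , (λ { zero → refl })
             , (λ { zero zero → sym (adj-irrefl G zero) })
    }

  length≤ : ∀ {S : List V} → Unique S → length S ≤ suc n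
  length≤ u = injective⇒≤ (lookup-injective u)

  growAll : ∀ fuel {S} → suc n ≤ length S + fuel → Layout S → ∃ λ S → (∀ z → z ∈ S) × Layout S
  growAll fuel {S} le L with any? (λ z → ¬? (z ∈? S))
  ... | no none = S , (λ z → decidable-stable (z ∈? S) (λ z∉ → none (z , z∉))) , L
  ... | yes (z , z∉S) with grow z∉S L
  -- Here `S` already has at least `suc n` entries, so `w ∷ S` would be a repetition-free list
  -- longer than the vertex set.
  growAll zero le L | yes _ | w , _ , L′ =
    ⊥-elim (ℕ.1+n≰n (ℕ.≤-trans (length≤ (Layout.unique L′)) (subst (suc n ≤_) (ℕ.+-identityʳ _) le)))
  growAll (suc fuel) {S} le L | yes _ | w , _ , L′ =
    growAll fuel (subst (suc n ≤_) (ℕ.+-suc (length S) fuel) le) L′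

  -- The expression is indexed by `length S`, which equals `suc n` only propositionally; with a
  -- variable `m` the equation can be matched.
  fromExpr : ∀ {m K} (σ : V ↔ Fin m) → m ≡ suc n → (e : CWExpr K m) →
    (∀ x y → adj G x y ≡ edge e (Inverse.to σ x) (Inverse.to σ y)) → CliqueWidth≤ G K
  fromExpr σ refl e eq = e , σ , eq

  Typing⇒CliqueWidth≤ : CliqueWidth≤ G (k + k)
  Typing⇒CliqueWidth≤ with growAll (suc n) (ℕ.m≤n+m _ 1) initial
  ... | S , all∈S , L with Layout.prefix L
  ... | e , _ , e-edge = fromExpr σ length≡ e λ x y → sym (trans (e-edge _ _)
          (sym (cong₂ (adj G) (lookup-index (all∈S x)) (lookup-index (all∈S y)))))
    where
    to : V → Fin (length S)
    to z = index (all∈S z)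
    from-to : ∀ z → lookup S (to z) ≡ z
    from-to z = sym (lookup-index (all∈S z))
    to-from : ∀ i → to (lookup S i) ≡ i
    to-from i = lookup-injective (Layout.unique L) (from-to _)
    σ : V ↔ Fin (length S)
    σ = mk↔ₛ′ to (lookup S) to-from from-to
    length≡ : length S ≡ suc n
    length≡ = ℕ.≤-antisym (length≤ (Layout.unique L))
      (injective⇒≤ λ {x} {y} eq → trans (sym (from-to x)) (trans (cong (lookup S) eq) (from-to y)))

-- Putting deleted vertices back

Typing-∷ : ∀ {n t} {G : Graph n} {X} x → Typing G t X → Typing G t (x ∷ X)
Typing-∷ x T = record
  { type = type ; M = M ; M-sym = M-sym
  ; flipped = λ w w∉ → let (d₁ , d₂ , bound) = flipped w (w∉ ∘ there) in
      d₁ , d₂ , λ z z∉ → bound z (z∉ ∘ there)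
  }
  where open Typing T

private
  bit : Bool → Fin 2
  bit false = zero
  bit true  = suc zero
  unbit : Fin 2 → Bool
  unbit zero = false
  unbit (suc _) = true
  unbit-bit : ∀ b → unbit (bit b) ≡ b
  unbit-bit false = refl
  unbit-bit true = refl

-- The vertex x gets a type of its own, and the other types are split by adjacency to x.
absorb : ∀ {n t} {G : Graph n} {X} x → Typing G t (x ∷ X) → Typing G (suc (2 * t)) X
absorb {n} {t} {G} {X} x T = record
  { type = type′ ; M = M′ ; M-sym = M′-sym ; flipped = flipped′ }
  where
  open Typing T
  inner : Fin n → Fin (2 * t)
  inner y = combine (bit (adj G x y)) (type y)
  adjacent : Fin (2 * t) → Bool
  adjacent c = unbit (proj₁ (remQuot t c))
  outer : Fin (2 * t) → Fin t
  outer c = proj₂ (remQuot {2} t c)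
  adjacent-inner : ∀ y → adjacent (inner y) ≡ adj G x y
  adjacent-inner y = trans (cong (unbit ∘ proj₁) (remQuot-combine (bit (adj G x y)) (type y)))
                           (unbit-bit _)
  outer-inner : ∀ y → outer (inner y) ≡ type y
  outer-inner y = cong proj₂ (remQuot-combine (bit (adj G x y)) (type y))
  type′ : Fin n → Fin (suc (2 * t))
  type′ y with y ≟ x
  ... | yes _ = zero
  ... | no _  = suc (inner y)
  M′ : Fin (suc (2 * t)) → Fin (suc (2 * t)) → Bool
  M′ zero zero = false
  M′ zero (suc c) = adjacent c
  M′ (suc c) zero = adjacent c
  M′ (suc c) (suc d) = M (outer c) (outer d)
  M′-sym : ∀ c d → M′ c d ≡ M′ d c
  M′-sym zero zero = refl
  M′-sym zero (suc d) = refl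
  M′-sym (suc c) zero = refl
  M′-sym (suc c) (suc d) = M-sym _ _
  flipped′ : ∀ w → w ∉ X → Σ (Fin n) λ d₁ → Σ (Fin n) λ d₂ →
      ∀ z → z ∉ X → z ≢ w → adj G w z ≢ M′ (type′ w) (type′ z) → z ≡ d₁ ⊎ z ≡ d₂
  flipped′ w w∉X with w ≟ x
  -- `M′` predicts every pair at `x` correctly, so both candidates are placeholders.
  ... | yes refl = x , x , λ z → from-x z
    where
    from-x : ∀ z → z ∉ X → z ≢ x → adj G x z ≢ M′ zero (type′ z) → z ≡ x ⊎ z ≡ x
    from-x z z∉X z≢x ne with z ≟ x
    ... | yes z≡x = inj₁ z≡x
    ... | no _ = ⊥-elim (ne (sym (adjacent-inner z)))
  ... | no w≢x with flipped w (∉-∷ w≢x w∉X)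
  ...   | d₁ , d₂ , bound = d₁ , d₂ , from-w
    where
    from-w : ∀ z → z ∉ X → z ≢ w → adj G w z ≢ M′ (suc (inner w)) (type′ z) → z ≡ d₁ ⊎ z ≡ d₂
    from-w z z∉X z≢w ne with z ≟ x
    ... | yes refl = ⊥-elim (ne (trans (adj-sym G w x) (sym (adjacent-inner w))))
    ... | no z≢x = bound z (∉-∷ z≢x z∉X) z≢w λ eq →
          ne (trans eq (sym (cong₂ M (outer-inner w) (outer-inner z))))

typeCount : ℕ → ℕ → ℕ
typeCount zero    t = t
typeCount (suc c) t = typeCount c (suc (2 * t))

-- Exactly `c` absorptions are made whatever the length of `X`, so that the number of types depends
-- on `c` and `t` alone; a short list is padded with the vertex `zero`.
absorbAll : ∀ {n t} {G : Graph (suc n)} c {X} → length X ≤ c → Typing G t X → Typing G (typeCount c t) []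
absorbAll zero    {[]}    _        T = T
absorbAll (suc c) {[]}    _        T = absorbAll c z≤n (absorb zero (Typing-∷ zero T))
absorbAll (suc c) {x ∷ X} (s≤s le) T = absorbAll c le (absorb x T)

-- Ramsey's theorem

true≢false : ∀ {b} → b ≡ true → b ≢ false
true≢false refl ()

record Homogeneous {n} (G : Graph n) (b : Bool) (r : ℕ) (P : Fin n → Set) : Set where
  field
    at       : Fin r → Fin n
    distinct : ∀ {i j} → i ≢ j → at i ≢ at j
    adjacent : ∀ {i j} → i ≢ j → adj G (at i) (at j) ≡ b
    inside   : ∀ i → P (at i)

Cover : ∀ {n} → ℕ → (Fin n → Set) → Set
Cover m P = Σ (List _) λ X → length X ≤ m × (∀ z → P z → z ∈ X)

ramseyBound : ℕ → ℕ → ℕ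
ramseyBound zero    s       = 0
ramseyBound (suc r) zero    = 0
ramseyBound (suc r) (suc s) = suc (ramseyBound r (suc s) + ramseyBound (suc r) s)

length-++-≤ : ∀ {A : Set} (X Y : List A) {a b} → length X ≤ a → length Y ≤ b → length (X ++ Y) ≤ a + b
length-++-≤ X Y p q = ℕ.≤-trans (ℕ.≤-reflexive (length-++ X)) (ℕ.+-mono-≤ p q)

module _ {n} (G : Graph n) where

  cons : ∀ {b r} {P Q : Fin n → Set} v → P v →
    (∀ {z} → Q z → P z × z ≢ v × adj G v z ≡ b) → Homogeneous G b r Q → Homogeneous G b (suc r) P
  cons v Pv link h = record
    { at = v ◂ at
    ; distinct = λ
        { {zero} {zero} ne → ⊥-elim (ne refl)
        ; {zero} {suc j} ne → proj₁ (proj₂ (link (inside j))) ∘ sym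
        ; {suc i} {zero} ne → proj₁ (proj₂ (link (inside i)))
        ; {suc i} {suc j} ne → distinct (ne ∘ cong suc)
        }
    ; adjacent = λ
        { {zero} {zero} ne → ⊥-elim (ne refl)
        ; {zero} {suc j} ne → proj₂ (proj₂ (link (inside j)))
        ; {suc i} {zero} ne → trans (adj-sym G _ _) (proj₂ (proj₂ (link (inside i))))
        ; {suc i} {suc j} ne → adjacent (ne ∘ cong suc)
        }
    ; inside = λ { zero → Pv ; (suc i) → proj₁ (link (inside i)) }
    }
    where open Homogeneous h

  widen : ∀ {b r} {P Q : Fin n → Set} → (∀ {z} → Q z → P z) → Homogeneous G b r Q → Homogeneous G b r P
  widen sub h = record { at = at ; distinct = distinct ; adjacent = adjacent ; inside = sub ∘ inside }
    where open Homogeneous h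

  empty : ∀ {b P} → Homogeneous G b 0 P
  empty = record { at = λ () ; distinct = λ { {()} } ; adjacent = λ { {()} } ; inside = λ () }

  abstract
    -- Induction on `r` and `s`: the neighbours and the non-neighbours of a vertex `v` of `P` are
    -- treated separately. A homogeneous set found there either is large enough or becomes so by
    -- adding `v`; failing both, the two covers and `v` cover `P`. The outcome is a cover because
    -- this is the set that gets deleted.
    ramsey : ∀ r s {P : Fin n → Set} → (∀ z → Dec (P z)) →
      Homogeneous G true r P ⊎ Homogeneous G false s P ⊎ Cover (ramseyBound r s) P
    ramsey zero    s       P? = inj₁ empty
    ramsey (suc r) zero    P? = inj₂ (inj₁ empty)
    ramsey (suc r) (suc s) {P} P? with any? P?
    ... | no none = inj₂ (inj₂ ([] , z≤n , λ z Pz → ⊥-elim (none (z , Pz))))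
    ... | yes (v , Pv) with ramsey r (suc s) (nbr? true) | ramsey (suc r) s (nbr? false)
      where
      nbr? : ∀ b z → Dec (P z × z ≢ v × adj G v z ≡ b)
      nbr? b z = P? z ×-dec (¬? (z ≟ v) ×-dec (adj G v z Bool.≟ b))
    ... | inj₁ h | _ = inj₁ (cons v Pv (λ q → q) h)
    ... | inj₂ (inj₁ h) | _ = inj₂ (inj₁ (widen proj₁ h))
    ... | _ | inj₁ h = inj₁ (widen proj₁ h)
    ... | _ | inj₂ (inj₁ h) = inj₂ (inj₁ (cons v Pv (λ q → q) h))
    ... | inj₂ (inj₂ (X , X≤ , X⊇)) | inj₂ (inj₂ (Y , Y≤ , Y⊇)) =
      inj₂ (inj₂ (v ∷ X ++ Y , s≤s (length-++-≤ X Y X≤ Y≤) , covers))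
      where
      covers : ∀ z → P z → z ∈ v ∷ X ++ Y
      covers z Pz with z ≟ v | adj G v z in eq
      ... | yes z≡v | _ = here z≡v
      ... | no z≢v | true = there (∈-++⁺ˡ (X⊇ z (Pz , z≢v , eq)))
      ... | no z≢v | false = there (∈-++⁺ʳ X (Y⊇ z (Pz , z≢v , eq)))

-- Results of exhaustive checks are abstract because unfolding them is prohibitively slow.
abstract
  K4-twinless : ∀ x y → (∀ z → adj K4 x z ≡ adj K4 y z) → x ≡ y
  K4-twinless = from-yes (all? λ x → all? λ y →
    (all? λ z → adj K4 x z Bool.≟ adj K4 y z) →-dec (x ≟ y))

  2P1+P3-twins : ∀ x y → (∀ z → adj 2P1+P3 x z ≡ adj 2P1+P3 y z) →
    x ≡ y ⊎ ((x ≡ 0F × y ≡ 1F) ⊎ (x ≡ 1F × y ≡ 0F)) ⊎ ((x ≡ 2F × y ≡ 4F) ⊎ (x ≡ 4F × y ≡ 2F))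
  2P1+P3-twins = from-yes (all? λ x → all? λ y →
    (all? λ z → adj 2P1+P3 x z Bool.≟ adj 2P1+P3 y z) →-dec
    ((x ≟ y) ⊎-dec ((x ≟ 0F ×-dec y ≟ 1F) ⊎-dec (x ≟ 1F ×-dec y ≟ 0F))
             ⊎-dec ((x ≟ 2F ×-dec y ≟ 4F) ⊎-dec (x ≟ 4F ×-dec y ≟ 2F))))

  -- This is the reason for taking independent sets of size five: three vertices with one
  -- exceptional index each still leave two indices at which all three behave regularly.
  twoOutside : ∀ (a b c : Fin 5) → ∃₂ λ i j →
    i ≢ j × (i ≢ a × i ≢ b × i ≢ c) × (j ≢ a × j ≢ b × j ≢ c)
  twoOutside = from-yes (all? {5} λ a → all? λ b → all? λ c → any? λ i → any? λ j →
    ¬? (i ≟ j) ×-dec ((¬? (i ≟ a) ×-dec ¬? (i ≟ b) ×-dec ¬? (i ≟ c))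
               ×-dec (¬? (j ≟ a) ×-dec ¬? (j ≟ b) ×-dec ¬? (j ≟ c))))

-- Sequences with at most one exception and sets with at most two elements

≢not : ∀ {x b} → x ≢ not b → x ≡ b
≢not {true} {true} ne = refl
≢not {true} {false} ne = ⊥-elim (ne refl)
≢not {false} {true} ne = ⊥-elim (ne refl)
≢not {false} {false} ne = refl

near-constant : ∀ {m} b (f : Fin (suc m) → Bool) →
  (∃ λ e → ∀ i → i ≢ e → f i ≡ b) ⊎ (∃₂ λ i j → i ≢ j × f i ≡ not b × f j ≡ not b)
near-constant b f with any? (λ i → f i Bool.≟ not b)
... | no none = inj₁ (zero , λ i _ → ≢not λ eq → none (i , eq))
... | yes (e , fe) with any? (λ j → ¬? (e ≟ j) ×-dec (f j Bool.≟ not b))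
...   | yes (j , e≢j , fj) = inj₂ (e , j , e≢j , fe , fj)
...   | no none = inj₁ (e , λ i i≢e → ≢not λ eq → none (i , i≢e ∘ sym , eq))

-- `flipped` has to name candidates even when there are none; `v` is the filler in that case.
uniqueOf : ∀ {n} {Q : Fin n → Set} → Fin n → (∀ z → Dec (Q z)) → (∀ {x y} → Q x → Q y → x ≡ y) →
  ∃ λ d → ∀ z → Q z → z ≡ d
uniqueOf v Q? unique with any? Q?
... | yes (d , Qd) = d , λ z Qz → unique Qz Qd
... | no none = v , λ z Qz → ⊥-elim (none (z , Qz))

twoOf : ∀ {n} {Q : Fin n → Set} → Fin n → (∀ z → Dec (Q z)) →
  (∀ {x y z} → Q x → Q y → Q z → x ≢ y → x ≢ z → y ≢ z → ⊥) →
  ∃₂ λ d₁ d₂ → ∀ z → Q z → z ≡ d₁ ⊎ z ≡ d₂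
twoOf v Q? noThree with any? Q?
... | no none = v , v , λ z Qz → ⊥-elim (none (z , Qz))
... | yes (d , Qd) with uniqueOf v (λ z → Q? z ×-dec ¬? (z ≟ d)) (λ {x} {y} (Qx , x≢d) (Qy , y≢d) →
        decidable-stable (x ≟ y) λ x≢y → noThree Qx Qy Qd x≢y x≢d y≢d)
...   | d′ , bound = d , d′ , λ z Qz → case z ≟ d of λ where
          (yes z≡d) → inj₁ z≡d
          (no z≢d) → inj₂ (bound z (Qz , z≢d))

-- Structure of (K₄, 2P₁+P₃)-free graphs

open Homogeneous

==-sym : ∀ {n} (x y : Fin n) → (x == y) ≡ (y == x)
==-sym x y with x ≟ y
... | yes x≡y = sym (==-true (sym x≡y))
... | no x≢y = sym (==-false (x≢y ∘ sym))

module _ {n} {G : Graph n} (free : Free K4 2P1+P3 G) where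

  infix 4 _~_ _≁_
  _~_ _≁_ : Fin n → Fin n → Set
  x ~ y = adj G x y ≡ true
  x ≁ y = adj G x y ≡ false

  flip~ : ∀ {b x y} → adj G x y ≡ b → adj G y x ≡ b
  flip~ eq = trans (adj-sym G _ _) eq

  adjacentUnless : ∀ {x y} → (x ≁ y → ⊥) → x ~ y
  adjacentUnless ne = ≢not ne

  nonadjacentUnless : ∀ {x y} → (x ~ y → ⊥) → x ≁ y
  nonadjacentUnless ne = ≢not ne

  noK4 : ∀ {a b c d} → a ~ b → a ~ c → a ~ d → b ~ c → b ~ d → c ~ d → ⊥
  noK4 {a} {b} {c} {d} ab ac ad bc bd cd = proj₁ free (f , injective , preserves)
    where
    f : Fin 4 → Fin n
    f 0F = a
    f 1F = b
    f 2F = c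
    f 3F = d
    preserves : ∀ x y → adj K4 x y ≡ adj G (f x) (f y)
    preserves 0F 0F = sym (adj-irrefl G a)
    preserves 0F 1F = sym ab
    preserves 0F 2F = sym ac
    preserves 0F 3F = sym ad
    preserves 1F 0F = sym (flip~ ab)
    preserves 1F 1F = sym (adj-irrefl G b)
    preserves 1F 2F = sym bc
    preserves 1F 3F = sym bd
    preserves 2F 0F = sym (flip~ ac)
    preserves 2F 1F = sym (flip~ bc)
    preserves 2F 2F = sym (adj-irrefl G c)
    preserves 2F 3F = sym cd
    preserves 3F 0F = sym (flip~ ad)
    preserves 3F 1F = sym (flip~ bd)
    preserves 3F 2F = sym (flip~ cd)
    preserves 3F 3F = sym (adj-irrefl G d)
    injective : ∀ {x y} → f x ≡ f y → x ≡ y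
    -- Vertices with the same image have the same neighbourhood, and `K4` has no twins.
    injective {x} {y} eq = K4-twinless x y λ z →
      trans (preserves x z) (trans (cong (λ v → adj G v (f z)) eq) (sym (preserves y z)))

  noHomogeneous₄ : ∀ {P} → ¬ Homogeneous G true 4 P
  noHomogeneous₄ h = noK4 (adjacent h {0F} {1F} λ ()) (adjacent h {0F} {2F} λ ())
    (adjacent h {0F} {3F} λ ()) (adjacent h {1F} {2F} λ ()) (adjacent h {1F} {3F} λ ())
    (adjacent h {2F} {3F} λ ())

  -- The adjacencies already separate all vertices except the twins: the two isolated vertices, and
  -- the two ends of the path. Hence just `a ≢ b` and `u ≢ w` are assumed.
  no2P1+P3 : ∀ {a b u v w} → a ≢ b → u ≢ w → a ≁ b → a ≁ u → a ≁ v → a ≁ w →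
    b ≁ u → b ≁ v → b ≁ w → u ~ v → v ~ w → u ≁ w → ⊥
  no2P1+P3 {a} {b} {u} {v} {w} a≢b u≢w ab au av aw bu bv bw uv vw uw =
    proj₂ free (f , injective , preserves)
    where
    f : Fin 5 → Fin n
    f 0F = a
    f 1F = b
    f 2F = u
    f 3F = v
    f 4F = w
    preserves : ∀ x y → adj 2P1+P3 x y ≡ adj G (f x) (f y)
    preserves 0F 0F = sym (adj-irrefl G a)
    preserves 0F 1F = sym ab
    preserves 0F 2F = sym au
    preserves 0F 3F = sym av
    preserves 0F 4F = sym aw
    preserves 1F 0F = sym (flip~ ab)
    preserves 1F 1F = sym (adj-irrefl G b)
    preserves 1F 2F = sym bu
    preserves 1F 3F = sym bv
    preserves 1F 4F = sym bw
    preserves 2F 0F = sym (flip~ au)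
    preserves 2F 1F = sym (flip~ bu)
    preserves 2F 2F = sym (adj-irrefl G u)
    preserves 2F 3F = sym uv
    preserves 2F 4F = sym uw
    preserves 3F 0F = sym (flip~ av)
    preserves 3F 1F = sym (flip~ bv)
    preserves 3F 2F = sym (flip~ uv)
    preserves 3F 3F = sym (adj-irrefl G v)
    preserves 3F 4F = sym vw
    preserves 4F 0F = sym (flip~ aw)
    preserves 4F 1F = sym (flip~ bw)
    preserves 4F 2F = sym (flip~ uw)
    preserves 4F 3F = sym (flip~ vw)
    preserves 4F 4F = sym (adj-irrefl G w)
    injective : ∀ {x y} → f x ≡ f y → x ≡ y
    injective {x} {y} eq with 2P1+P3-twins x y (λ z →
      trans (preserves x z) (trans (cong (λ v → adj G v (f z)) eq) (sym (preserves y z))))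
    ... | inj₁ x≡y = x≡y
    ... | inj₂ (inj₁ (inj₁ (refl , refl))) = ⊥-elim (a≢b eq)
    ... | inj₂ (inj₁ (inj₂ (refl , refl))) = ⊥-elim (a≢b (sym eq))
    ... | inj₂ (inj₂ (inj₁ (refl , refl))) = ⊥-elim (u≢w eq)
    ... | inj₂ (inj₂ (inj₂ (refl , refl))) = ⊥-elim (u≢w (sym eq))

  -- Vertices low or high for an independent set of size five

  Independent₅ : Set
  Independent₅ = Homogeneous G false 5 (λ _ → ⊤)

  Near : Bool → Independent₅ → Fin n → Set
  Near b I v = ∃ λ e → ∀ i → i ≢ e → adj G v (at I i) ≡ b

  Low High : Independent₅ → Fin n → Set
  Low  = Near false
  High = Near true

  abstract
    near? : ∀ b I v → Dec (Near b I v)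
    near? b I v = any? λ e → all? λ i → ¬? (i ≟ e) →-dec (adj G v (at I i) Bool.≟ b)

  -- Otherwise `v` has two neighbours and two non-neighbours in `I`; with `v` as the middle of the
  -- path, these five vertices induce `2P1+P3`.
  low⊎high : ∀ I v → Low I v ⊎ High I v
  low⊎high I v with near-constant false (adj G v ∘ at I) | near-constant true (adj G v ∘ at I)
  ... | inj₁ low | _ = inj₁ low
  ... | _ | inj₁ high = inj₂ high
  ... | inj₂ (i , j , i≢j , vi , vj) | inj₂ (k , l , k≢l , vk , vl) =
    ⊥-elim (no2P1+P3 (distinct I k≢l) (distinct I i≢j) (adjacent I k≢l)
      (adjacent I (apart vk vi)) (flip~ vk) (adjacent I (apart vk vj))
      (adjacent I (apart vl vi)) (flip~ vl) (adjacent I (apart vl vj))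
      (flip~ vi) vj (adjacent I i≢j))
    where
    apart : ∀ {x y} → v ≁ at I x → v ~ at I y → x ≢ y
    apart vx vy refl = true≢false vy vx

  common : ∀ {b} I {x y} → Near b I x → Near b I y →
    ∃ λ i → adj G x (at I i) ≡ b × adj G y (at I i) ≡ b
  common I (e , x-near) (e′ , y-near) with twoOutside e e′ e
  ... | i , _ , _ , (i≢e , i≢e′ , _) , _ = i , x-near i i≢e , y-near i i≢e′

  -- Two vertices of `I` miss all of `u`, `v`, `w`, so an induced path on these three would complete
  -- a `2P1+P3`.
  low-transitive : ∀ I {u v w} → Low I u → Low I v → Low I w → u ~ v → v ~ w → u ≢ w → u ~ w
  low-transitive I (a , u-low) (b , v-low) (c , w-low) uv vw u≢w with twoOutside a b c
  ... | i , j , i≢j , (i≢a , i≢b , i≢c) , (j≢a , j≢b , j≢c) = adjacentUnless λ u≁w →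
    no2P1+P3 (distinct I i≢j) u≢w (adjacent I i≢j)
      (flip~ (u-low i i≢a)) (flip~ (v-low i i≢b)) (flip~ (w-low i i≢c))
      (flip~ (u-low j j≢a)) (flip~ (v-low j j≢b)) (flip~ (w-low j j≢c)) uv vw u≁w

  -- A common neighbour in `I` would extend the triangle to a `K4`.
  high-triangleFree : ∀ I {u v w} → High I u → High I v → High I w → u ~ v → u ~ w → v ~ w → ⊥
  high-triangleFree I (a , u-high) (b , v-high) (c , w-high) uv uw vw with twoOutside a b c
  ... | i , _ , _ , (i≢a , i≢b , i≢c) , _ = noK4 uv uw (u-high i i≢a) vw (v-high i i≢b) (w-high i i≢c)

  -- Two vertices of `I` are adjacent to `h` and miss `x` and `y`. They form a path with middle `h`,
  -- to which nonadjacent `x` and `y` would add two isolated vertices.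
  missed-clique : ∀ I {h x y} → High I h → Low I x → Low I y → h ≁ x → h ≁ y → x ≢ y → x ~ y
  missed-clique I (a , h-high) (b , x-low) (c , y-low) hx hy x≢y with twoOutside a b c
  ... | i , j , i≢j , (i≢a , i≢b , i≢c) , (j≢a , j≢b , j≢c) = adjacentUnless λ x≁y →
    no2P1+P3 x≢y (distinct I i≢j) x≁y
      (x-low i i≢b) (flip~ hx) (x-low j j≢b) (y-low i i≢c) (flip~ hy) (y-low j j≢c)
      (flip~ (h-high i i≢a)) (h-high j j≢a) (adjacent I i≢j)

  -- Some vertex of `J` misses both `x` and `y`; being high for `I`, it can serve as `h` in
  -- `missed-clique`.
  lowlow-clique : ∀ I J → (∀ i → High I (at J i)) → ∀ {x y} →
    Low I x × Low J x → Low I y × Low J y → x ≢ y → x ~ y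
  lowlow-clique I J J⊆High (x-I , x-J) (y-I , y-J) with common J x-J y-J
  ... | i , xi , yi = missed-clique I (J⊆High i) x-I y-I (flip~ xi) (flip~ yi)

  coverClique : ∀ {P : Fin n → Set} → (∀ v → Dec (P v)) →
    (∀ {x y} → P x → P y → x ≢ y → x ~ y) → Cover (ramseyBound 4 2) P
  coverClique P? clique with ramsey G 4 2 P?
  ... | inj₁ h = ⊥-elim (noHomogeneous₄ h)
  ... | inj₂ (inj₁ h) = ⊥-elim (true≢false
          (clique (inside h 0F) (inside h 1F) (distinct h λ ())) (adjacent h λ ()))
  ... | inj₂ (inj₂ cover) = cover

  -- Typings from partitions into at most three parts

  AtMostTwoFlips : List (Fin n) → (Fin 3 → Fin n → Set) → Fin 3 → Fin n → Set
  AtMostTwoFlips X P c w = ∃₂ λ d₁ d₂ →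
    ∀ {z d} → z ∉ X → P d z → z ≢ w → adj G w z ≢ not (c == d) → z ≡ d₁ ⊎ z ≡ d₂

  -- The predicates `P c` may overlap: `classify` selects the type of a vertex, and `flips` holds
  -- for whichever part it selects.
  multipartite : ∀ X (P : Fin 3 → Fin n → Set) → (∀ v → v ∉ X → ∃ λ c → P c v) →
    (∀ {w c} → w ∉ X → P c w → AtMostTwoFlips X P c w) →
    Typing G 3 X
  multipartite X P classify flips = record
    { type = part
    ; M = λ c d → not (c == d)
    ; M-sym = λ c d → cong not (==-sym c d)
    ; flipped = λ w w∉ → let (d₁ , d₂ , bound) = flips w∉ (part-correct w w∉) in
        d₁ , d₂ , λ z z∉ → bound z∉ (part-correct z z∉)
    }
    where
    part : Fin n → Fin 3
    part v with v ∈? X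
    ... | yes _ = 0F
    ... | no v∉ = proj₁ (classify v v∉)
    part-correct : ∀ v → v ∉ X → P (part v) v
    part-correct v v∉ with v ∈? X
    ... | yes v∈ = ⊥-elim (v∉ v∈)
    ... | no v∉′ = proj₂ (classify v v∉′)

  abstract
    others : ∀ (c : Fin 3) → ∃₂ λ c₁ c₂ → ∀ d → d ≢ c → d ≡ c₁ ⊎ d ≡ c₂
    others = from-yes (all? {3} λ c → any? λ c₁ → any? λ c₂ → all? λ d →
      ¬? (d ≟ c) →-dec ((d ≟ c₁) ⊎-dec (d ≟ c₂)))

  -- Nothing is flipped inside a part, and a vertex misses at most one vertex of each of the two
  -- other parts.
  threeParts : ∀ X {P : Fin 3 → Fin n → Set} → (∀ c v → Dec (P c v)) →
    (∀ v → v ∉ X → ∃ λ c → P c v) →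
    (∀ {c v w} → v ∉ X → w ∉ X → P c v → P c w → v ≁ w) →
    (∀ {c d w x y} → c ≢ d → x ∉ X → y ∉ X → P c w → P d x → P d y → w ≁ x → w ≁ y → x ≡ y) →
    Typing G 3 X
  threeParts X {P} P? classify indep match = multipartite X P classify flips
    where
    flips : ∀ {w c} → w ∉ X → P c w → AtMostTwoFlips X P c w
    flips {w} {c} w∉ Pw = proj₁ (miss c₁) , proj₁ (miss c₂) , bound
      where
      c₁ = proj₁ (others c)
      c₂ = proj₁ (proj₂ (others c))
      Missed : Fin 3 → Fin n → Set
      Missed d z = (z ∉ X × P d z × w ≁ z) × c ≢ d
      miss : ∀ d → ∃ λ e → ∀ z → Missed d z → z ≡ e
      miss d = uniqueOf w
        (λ z → (¬? (z ∈? X) ×-dec (P? d z ×-dec (adj G w z Bool.≟ false))) ×-dec ¬? (c ≟ d))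
        (λ ((x∉ , Px , wx) , c≢d) ((y∉ , Py , wy) , _) → match c≢d x∉ y∉ Pw Px Py wx wy)
      bound : ∀ {z d} → z ∉ X → P d z → z ≢ w → adj G w z ≢ not (c == d) →
        z ≡ proj₁ (miss c₁) ⊎ z ≡ proj₁ (miss c₂)
      bound {z} {d} z∉ Pz z≢w ne with c ≟ d
      ... | yes refl = ⊥-elim (ne (indep w∉ z∉ Pw Pz))
      ... | no c≢d with proj₂ (proj₂ (others c)) d (c≢d ∘ sym)
      ...   | inj₁ refl = inj₁ (proj₂ (miss d) z ((z∉ , Pz , ≢not ne) , c≢d))
      ...   | inj₂ refl = inj₂ (proj₂ (miss d) z ((z∉ , Pz , ≢not ne) , c≢d))

  -- A vertex of `A` misses at most two vertices of `C`, since three would form a triangle. A vertex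
  -- of `C` misses at most one vertex of the independent `A`, and has at most one neighbour in `C`,
  -- where components are cliques without triangles.
  twoParts : ∀ X {A C : Fin n → Set} → (∀ v → Dec (A v)) → (∀ v → Dec (C v)) →
    (∀ v → v ∉ X → A v ⊎ C v) →
    (∀ {x y} → x ∉ X → y ∉ X → A x → A y → x ≁ y) →
    (∀ {a x y} → A a → C x → C y → a ≁ x → a ≁ y → x ≢ y → x ~ y) →
    (∀ {c x y} → C c → A x → A y → c ≁ x → c ≁ y → x ≢ y → x ~ y) →
    (∀ {x y z} → C x → C y → C z → x ~ y → y ~ z → x ≢ z → x ~ z) →
    (∀ {x y z} → C x → C y → C z → x ~ y → x ~ z → y ~ z → ⊥) →
    Typing G 3 X
  twoParts X {A} {C} A? C? A⊎C A-indep A-missed C-missed C-trans C-free =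
    multipartite X P classified flips
    where
    P : Fin 3 → Fin n → Set
    P 0F = A
    P 1F = C
    P 2F _ = ⊥
    classified : ∀ v → v ∉ X → ∃ λ c → P c v
    classified v v∉ with A⊎C v v∉
    ... | inj₁ Av = 0F , Av
    ... | inj₂ Cv = 1F , Cv
    flips : ∀ {w c} → w ∉ X → P c w → AtMostTwoFlips X P c w
    flips {w} {0F} w∉ Aw with twoOf w (λ z → C? z ×-dec (adj G w z Bool.≟ false))
      (λ (Cx , wx) (Cy , wy) (Cz , wz) x≢y x≢z y≢z → C-free Cx Cy Cz
        (A-missed Aw Cx Cy wx wy x≢y) (A-missed Aw Cx Cz wx wz x≢z) (A-missed Aw Cy Cz wy wz y≢z))
    ... | d₁ , d₂ , bound = d₁ , d₂ , λ
      { {d = 0F} z∉ Az _ ne → ⊥-elim (ne (A-indep w∉ z∉ Aw Az))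
      ; {d = 1F} z∉ Cz _ ne → bound _ (Cz , ≢not ne)
      ; {d = 2F} _ ()
      }
    flips {w} {1F} w∉ Cw
      with uniqueOf w (λ z → C? z ×-dec (adj G w z Bool.≟ true))
        (λ {x} {y} (Cx , wx) (Cy , wy) → decidable-stable (x ≟ y) λ x≢y →
          C-free Cw Cx Cy wx wy (C-trans Cx Cw Cy (flip~ wx) wy x≢y))
         | uniqueOf w (λ z → ¬? (z ∈? X) ×-dec (A? z ×-dec (adj G w z Bool.≟ false)))
        (λ {x} {y} (x∉ , Ax , wx) (y∉ , Ay , wy) → decidable-stable (x ≟ y) λ x≢y →
          true≢false (C-missed Cw Ax Ay wx wy x≢y) (A-indep x∉ y∉ Ax Ay))
    ... | d₁ , bound₁ | d₂ , bound₂ = d₁ , d₂ , λ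
      { {d = 0F} z∉ Az _ ne → inj₂ (bound₂ _ (z∉ , Az , ≢not ne))
      ; {d = 1F} z∉ Cz _ ne → inj₁ (bound₁ _ (Cz , ≢not ne))
      ; {d = 2F} _ ()
      }
    flips {w} {2F} _ ()

  -- `ramseyBound 4 5` is what the case without an independent set of size five requires; every
  -- other case deletes fewer vertices.
  Structured : Set
  Structured = Σ (List (Fin n)) λ X → length X ≤ ramseyBound 4 5 × Typing G 3 X

  trivialTyping : ∀ {X} → (∀ v → v ∈ X) → Typing G 3 X
  trivialTyping {X} all∈ = multipartite X (λ _ _ → ⊥) (λ v v∉ → ⊥-elim (v∉ (all∈ v)))
    (λ {w} w∉ → ⊥-elim (w∉ (all∈ w)))

  -- By `low-transitive`, three low neighbours of a low vertex would form a `K4` with it, so outside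
  -- `X` the graph itself has maximum degree two.
  onePart : ∀ I X → (∀ v → v ∉ X → Low I v) → Typing G 3 X
  onePart I X low = multipartite X P (λ v v∉ → 0F , refl , low v v∉) flips
    where
    P : Fin 3 → Fin n → Set
    P c v = c ≡ 0F × Low I v
    flips : ∀ {w c} → w ∉ X → P c w → AtMostTwoFlips X P c w
    flips {w} w∉ (refl , Lw) with twoOf w (λ z → near? false I z ×-dec (adj G w z Bool.≟ true))
      (λ (Lx , wx) (Ly , wy) (Lz , wz) x≢y x≢z y≢z → noK4 wx wy wz
        (low-transitive I Lx Lw Ly (flip~ wx) wy x≢y)
        (low-transitive I Lx Lw Lz (flip~ wx) wz x≢z)
        (low-transitive I Ly Lw Lz (flip~ wy) wz y≢z))
    ... | d₁ , d₂ , bound = d₁ , d₂ , λ where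
      z∉ (refl , Lz) _ ne → bound _ (Lz , ≢not ne)

  -- Two independent sets, the second among the vertices high for the first

  module _ (I J : Independent₅) (J⊆High : ∀ i → High I (at J i)) where

    A B C : Fin n → Set
    A v = Low I v × High J v
    B v = High I v × High J v
    C v = High I v × Low J v

    A? : ∀ v → Dec (A v)
    A? v = near? false I v ×-dec near? true J v
    B? : ∀ v → Dec (B v)
    B? v = near? true I v ×-dec near? true J v
    C? : ∀ v → Dec (C v)
    C? v = near? true I v ×-dec near? false J v

    -- An edge would form a triangle with a common neighbour in `J`, and all three vertices are high
    -- for `I`.
    B-independent : ∀ {x y} → B x → B y → x ≁ y
    B-independent (x-I , x-J) (y-I , y-J) with common J x-J y-J
    ... | i , xi , yi = nonadjacentUnless λ xy →
      high-triangleFree I x-I y-I (J⊆High i) xy xi yi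

    module _ {X₁} (X₁-covers : ∀ v → Low I v × Low J v → v ∈ X₁) where

      classify : ∀ v → v ∉ X₁ → A v ⊎ B v ⊎ C v
      classify v v∉ with low⊎high I v | low⊎high J v
      ... | inj₁ lI | inj₁ lJ = ⊥-elim (v∉ (X₁-covers v (lI , lJ)))
      ... | inj₁ lI | inj₂ hJ = inj₁ (lI , hJ)
      ... | inj₂ hI | inj₁ lJ = inj₂ (inj₂ (hI , lJ))
      ... | inj₂ hI | inj₂ hJ = inj₂ (inj₁ (hI , hJ))

    missedBy : ∀ K {h} → High K h → Cover (ramseyBound 4 2) (λ v → Low K v × h ≁ v)
    missedBy K {h} hK = coverClique (λ v → near? false K v ×-dec (adj G h v Bool.≟ false))
      (λ (lx , hx) (ly , hy) → missed-clique K hK lx ly hx hy)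

    -- With `B` deleted, `A` and `C` remain, and one of them must be made independent for
    -- `twoParts`. If `C` has no edges, it plays that role.
    withoutB : Cover (ramseyBound 2 5) B → Structured
    withoutB (X₂ , X₂≤ , X₂⊇)
      with coverClique (λ v → near? false I v ×-dec near? false J v) (lowlow-clique I J J⊆High)
         | any? (λ c → any? (λ c′ → C? c ×-dec (C? c′ ×-dec (adj G c c′ Bool.≟ true))))
    ... | X₁ , X₁≤ , X₁⊇ | no C-edgeless =
      X₁ ++ X₂ , ℕ.≤-trans (length-++-≤ X₁ X₂ X₁≤ X₂≤) (ℕ.≤ᵇ⇒≤ _ _ tt) ,
      twoParts (X₁ ++ X₂) C? A? C⊎A
        (λ {x} {y} _ _ Cx Cy → nonadjacentUnless λ xy → C-edgeless (x , y , Cx , Cy , xy))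
        (λ (hI , _) (lx , _) (ly , _) → missed-clique I hI lx ly)
        (λ (_ , hJ) (_ , lx) (_ , ly) → missed-clique J hJ lx ly)
        (λ (lx , _) (ly , _) (lz , _) → low-transitive I lx ly lz)
        (λ (_ , hx) (_ , hy) (_ , hz) → high-triangleFree J hx hy hz)
      where
      C⊎A : ∀ v → v ∉ X₁ ++ X₂ → C v ⊎ A v
      C⊎A v v∉ with classify X₁⊇ v (v∉ ∘ ∈-++⁺ˡ)
      ... | inj₁ Av = inj₂ Av
      ... | inj₂ (inj₁ Bv) = ⊥-elim (v∉ (∈-++⁺ʳ X₁ (X₂⊇ v Bv)))
      ... | inj₂ (inj₂ Cv) = inj₁ Cv
    -- Once the low vertices for `I` missed by `c` or `c′` are deleted, the rest of `A` lies in the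
    -- common neighbourhood of an edge, so it is independent by `K4`-freeness.
    ... | X₁ , X₁≤ , X₁⊇ | yes (c , c′ , (hc , _) , (hc′ , _) , cc′)
      with missedBy I hc | missedBy I hc′
    ... | Y , Y≤ , Y⊇ | Z , Z≤ , Z⊇ =
      X , ℕ.≤-trans (length-++-≤ X₁ _ X₁≤ (length-++-≤ X₂ _ X₂≤ (length-++-≤ Y Z Y≤ Z≤)))
            (ℕ.≤ᵇ⇒≤ _ _ tt) ,
      twoParts X A? C? A⊎C
        (λ x∉ y∉ (lx , _) (ly , _) → nonadjacentUnless λ xy →
          noK4 cc′ (cY lx x∉) (cY ly y∉) (cZ lx x∉) (cZ ly y∉) xy)
        (λ (_ , hJ) (_ , lx) (_ , ly) → missed-clique J hJ lx ly)
        (λ (hI , _) (lx , _) (ly , _) → missed-clique I hI lx ly)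
        (λ (_ , lx) (_ , ly) (_ , lz) → low-transitive J lx ly lz)
        (λ (hx , _) (hy , _) (hz , _) → high-triangleFree I hx hy hz)
      where
      X : List (Fin n)
      X = X₁ ++ X₂ ++ Y ++ Z
      cY : ∀ {v} → Low I v → v ∉ X → c ~ v
      cY lv v∉ = adjacentUnless λ cv → v∉ (∈-++⁺ʳ X₁ (∈-++⁺ʳ X₂ (∈-++⁺ˡ (Y⊇ _ (lv , cv)))))
      cZ : ∀ {v} → Low I v → v ∉ X → c′ ~ v
      cZ lv v∉ = adjacentUnless λ cv → v∉ (∈-++⁺ʳ X₁ (∈-++⁺ʳ X₂ (∈-++⁺ʳ Y (Z⊇ _ (lv , cv)))))
      A⊎C : ∀ v → v ∉ X → A v ⊎ C v
      A⊎C v v∉ with classify X₁⊇ v (v∉ ∘ ∈-++⁺ˡ)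
      ... | inj₁ Av = inj₁ Av
      ... | inj₂ (inj₁ Bv) = ⊥-elim (v∉ (∈-++⁺ʳ X₁ (∈-++⁺ˡ (X₂⊇ v Bv))))
      ... | inj₂ (inj₂ Cv) = inj₂ Cv

    -- The set `K` makes the vertices of `B` low for a set of their own, so that `missed-clique`
    -- applies to all three parts alike. Vertices low for two of the sets form cliques and are
    -- deleted.
    withB : (K : Independent₅) → (∀ i → B (at K i)) → Structured
    withB K K⊆B
      with coverClique (λ v → near? false I v ×-dec near? false J v) (lowlow-clique I J J⊆High)
         | coverClique (λ v → near? false I v ×-dec near? false K v)
             (lowlow-clique I K (proj₁ ∘ K⊆B))
         | coverClique (λ v → near? false J v ×-dec near? false K v)
             (lowlow-clique J K (proj₂ ∘ K⊆B))
         | missedBy I (proj₁ (K⊆B 0F)) | missedBy J (proj₂ (K⊆B 0F))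
    ... | X₁ , X₁≤ , X₁⊇ | X₂ , X₂≤ , X₂⊇ | X₃ , X₃≤ , X₃⊇ | Y , Y≤ , Y⊇ | Z , Z≤ , Z⊇ =
      X , ℕ.≤-trans (length-++-≤ X₁ _ X₁≤ (length-++-≤ X₂ _ X₂≤ (length-++-≤ X₃ _ X₃≤
                      (length-++-≤ Y Z Y≤ Z≤)))) (ℕ.≤ᵇ⇒≤ _ _ tt) ,
      threeParts X P? part independent match
      where
      X : List (Fin n)
      X = X₁ ++ X₂ ++ X₃ ++ Y ++ Z
      b : Fin n
      b = at K 0F
      bY : ∀ {v} → Low I v → v ∉ X → b ~ v
      bY lv v∉ = adjacentUnless λ bv →
        v∉ (∈-++⁺ʳ X₁ (∈-++⁺ʳ X₂ (∈-++⁺ʳ X₃ (∈-++⁺ˡ (Y⊇ _ (lv , bv))))))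
      bZ : ∀ {v} → Low J v → v ∉ X → b ~ v
      bZ lv v∉ = adjacentUnless λ bv →
        v∉ (∈-++⁺ʳ X₁ (∈-++⁺ʳ X₂ (∈-++⁺ʳ X₃ (∈-++⁺ʳ Y (Z⊇ _ (lv , bv))))))
      family : Fin 3 → Independent₅
      family 0F = I
      family 1F = K
      family 2F = J
      P : Fin 3 → Fin n → Set
      P c v = Low (family c) v × (∀ d → d ≢ c → High (family d) v)
      P? : ∀ c v → Dec (P c v)
      P? c v = near? false (family c) v ×-dec all? λ d → ¬? (d ≟ c) →-dec near? true (family d) v
      part : ∀ v → v ∉ X → ∃ λ c → P c v
      part v v∉ with classify X₁⊇ v (v∉ ∘ ∈-++⁺ˡ)
      ... | inj₁ (lI , hJ) with low⊎high K v
      ...   | inj₁ lK = ⊥-elim (v∉ (∈-++⁺ʳ X₁ (∈-++⁺ˡ (X₂⊇ v (lI , lK)))))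
      ...   | inj₂ hK = 0F , lI , λ { 0F ne → ⊥-elim (ne refl) ; 1F _ → hK ; 2F _ → hJ }
      -- A vertex of `B` misses all of `K`, since `K` lies in the independent set `B`; the
      -- exceptional index `0F` is arbitrary.
      part v v∉ | inj₂ (inj₁ (hI , hJ)) = 1F , (0F , λ i _ → B-independent (hI , hJ) (K⊆B i)) ,
        λ { 0F _ → hI ; 1F ne → ⊥-elim (ne refl) ; 2F _ → hJ }
      part v v∉ | inj₂ (inj₂ (hI , lJ)) with low⊎high K v
      ...   | inj₁ lK = ⊥-elim (v∉ (∈-++⁺ʳ X₁ (∈-++⁺ʳ X₂ (∈-++⁺ˡ (X₃⊇ v (lJ , lK))))))
      ...   | inj₂ hK = 2F , lJ , λ { 0F _ → hI ; 1F _ → hK ; 2F ne → ⊥-elim (ne refl) }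
      independent : ∀ {c v w} → v ∉ X → w ∉ X → P c v → P c w → v ≁ w
      -- After the deletion, `b` is adjacent to both vertices and, like them, high for `J`.
      independent {0F} v∉ w∉ (lv , hv) (lw , hw) = nonadjacentUnless λ vw →
        high-triangleFree J (proj₂ (K⊆B 0F)) (hv 2F λ ()) (hw 2F λ ()) (bY lv v∉) (bY lw w∉) vw
      independent {1F} v∉ w∉ (_ , hv) (_ , hw) =
        B-independent (hv 0F (λ ()) , hv 2F (λ ())) (hw 0F (λ ()) , hw 2F (λ ()))
      independent {2F} v∉ w∉ (lv , hv) (lw , hw) = nonadjacentUnless λ vw →
        high-triangleFree I (proj₁ (K⊆B 0F)) (hv 0F λ ()) (hw 0F λ ()) (bZ lv v∉) (bZ lw w∉) vw
      match : ∀ {c d w x y} → c ≢ d → x ∉ X → y ∉ X → P c w → P d x → P d y →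
        w ≁ x → w ≁ y → x ≡ y
      -- Since `w` is high for the set of part `d`, two vertices missed there would be adjacent
      -- inside an independent part.
      match {c} {d} {w} {x} {y} c≢d x∉ y∉ (_ , hw) Px@(lx , _) Py@(ly , _) wx wy =
        decidable-stable (x ≟ y) λ x≢y → true≢false
          (missed-clique (family d) (hw d (c≢d ∘ sym)) lx ly wx wy x≢y)
          (independent x∉ y∉ Px Py)

  -- Choosing the independent sets

  forget : ∀ {P} → Homogeneous G false 5 P → Independent₅
  forget = widen G (λ _ → tt)

  -- The clique sizes 4, 3 and 2 given to `ramsey` are those excluded in the whole graph, among the
  -- vertices high for `I`, and in `B`.
  structured : Structured
  structured with ramsey G 4 5 {λ _ → ⊤} (λ _ → yes tt)
  ... | inj₁ h = ⊥-elim (noHomogeneous₄ h)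
  ... | inj₂ (inj₂ (X , X≤ , X⊇)) = X , X≤ , trivialTyping (λ v → X⊇ v tt)
  ... | inj₂ (inj₁ I) with ramsey G 3 5 (near? true I)
  ...   | inj₁ h = ⊥-elim (high-triangleFree I (inside h 0F) (inside h 1F) (inside h 2F)
            (adjacent h λ ()) (adjacent h λ ()) (adjacent h λ ()))
  ...   | inj₂ (inj₂ (X , X≤ , X⊇)) = X , ℕ.≤-trans X≤ (ℕ.≤ᵇ⇒≤ _ _ tt) , onePart I X λ v v∉ →
          case low⊎high I v of λ where
            (inj₁ low) → low
            (inj₂ high) → ⊥-elim (v∉ (X⊇ v high))
  ...   | inj₂ (inj₁ J) with ramsey G 2 5 (B? I (forget J) (inside J))
  ...     | inj₁ h = ⊥-elim (true≢false (adjacent h λ ())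
              (B-independent I (forget J) (inside J) (inside h 0F) (inside h 1F)))
  ...     | inj₂ (inj₁ K) = withB I (forget J) (inside J) (forget K) (inside K)
  ...     | inj₂ (inj₂ cover) = withoutB I (forget J) (inside J) cover

theorem7 : Σ ℕ λ c → ∀ {n} (G : Graph (suc n)) → Free K4 2P1+P3 G → CliqueWidth≤ G c
theorem7 = (2 + t) + (2 + t) , λ G free → let (X , X≤ , T) = structured free in
  Typing⇒CliqueWidth≤ G (absorbAll (ramseyBound 4 5) X≤ T)
  where
  t : ℕ
  -- Three parts, refined once for each possible deleted vertex; the bound adds two private labels
  -- and doubles the total for the working space.
  t = typeCount (ramseyBound 4 5) 3
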